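{- Let $\tilde{G}=(\tilde{Q},\tilde{E},\tilde{\delta},\tilde{q}_0)$ be a fuzzy discrete event system with uncontrollability degrees $\tilde{E}_{uc}:\tilde{E}\to[0,1]$, and let $\mathcal{K}\subseteq\mathcal{L}_{\tilde{G}}$ be a nonempty (i.e. not identically $0$) controllable fuzzy language. Put $S_{\mathcal{K}}(\tilde{q})=\{\tilde{s}\in\tilde{E}^*:\mathcal{K}(\tilde{s})\cdot(\tilde{q}_0\circ\tilde{s})=\tilde{q}\}$ for $\tilde{q}\in\tilde{Q}$, and $$R(\mathcal{K})=\{\tilde{q}\in\tilde{Q}:\exists\,\tilde{s}\in\tilde{E}^*\text{ such that }\mathcal{K}(\tilde{s})\cdot(\tilde{q}_0\circ\tilde{s})=\tilde{q}\}.$$ If $\mathcal{K}$ is consistent, then: 1) $R(\mathcal{K})$ is a controllable fuzzy state set; 2) the function $f:\tilde{Q}\to\mathcal{F}(\tilde{E})$ defined by $$f(\tilde{q})(\tilde{a})=\Big(\bigvee_{\tilde{s}\in S_{\mathcal{K}}(\tilde{q})}\mathcal{K}(\tilde{s}\tilde{a})\Big)\vee\tilde{E}_{uc}(\tilde{a})$$ is a fuzzy state feedback controller for $\tilde{G}$ and $R(\tilde{G}^f)=R(\mathcal{K})$.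
   Context: Notation: $\wedge,\vee$ denote infimum (minimum) and supremum (maximum) in $[0,1]$, with $\bigvee\emptyset=0$. $\mathcal{F}(X)$ is the set of functions $X\to[0,1]$ (fuzzy subsets of $X$), ordered pointwise by $\subseteq$; $\cap$ is pointwise minimum. Fix $n\ge1$. $\tilde{Q}$ is the set of fuzzy states: all row vectors in $[0,1]^n$ other than the zero vector. A fuzzy event is an $n\times n$ matrix over $[0,1]$; $\tilde{E}$ is a finite set of fuzzy events; $\tilde{q}_0\in\tilde{Q}$ is the initial state. $\tilde{E}^*$ is the set of finite strings over $\tilde{E}$, with empty string $\epsilon$. The max-min composition is $(A\circ B)_{ij}=\bigvee_l(a_{il}\wedge b_{lj})$. For a string $\tilde{s}=\tilde{a}_1\cdots\tilde{a}_k$, $\tilde{q}\circ\tilde{s}$ means $\tilde{q}\circ\tilde{a}_1\circ\cdots\circ\tilde{a}_k$, and $\tilde{q}\circ\epsilon=\tilde{q}$. For $\lambda\in[0,1]$ and a vector $x$, $\lambda\cdot x$ is the vector with entries $\lambda\wedge x_i$. The (partial) transition function is $\tilde{\delta}(\tilde{q},\tilde{a})=\tilde{q}\circ\tilde{a}$, undefined when this is the zero vector. Each $\tilde{a}\in\tilde{E}$ has an uncontrollability degree $\tilde{E}_{uc}(\tilde{a})\in[0,1]$. A fuzzy state feedback controller (FSFC) for $\tilde{G}$ is a map $f:\tilde{Q}\to\mathcal{F}(\tilde{E})$ with $f(\tilde{q})(\tilde{a})\ge\tilde{E}_{uc}(\tilde{a})$ for all $\tilde{q},\tilde{a}$. The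 closed-loop system is $\tilde{G}^f=(\tilde{Q},\tilde{E},\tilde{\delta}^f,\tilde{q}_0)$ with $\tilde{\delta}^f(\tilde{q},\tilde{a})=f(\tilde{q})(\tilde{a})\cdot(\tilde{q}\circ\tilde{a})$, undefined when this is the zero vector, extended to strings by $\tilde{\delta}^f(\tilde{q},\epsilon)=\tilde{q}$, $\tilde{\delta}^f(\tilde{q},\tilde{s}\tilde{a})=\tilde{\delta}^f(\tilde{\delta}^f(\tilde{q},\tilde{s}),\tilde{a})$. $R(\tilde{G}^f)$ is the set of $\tilde{q}\in\tilde{Q}$ with $\tilde{q}=\tilde{\delta}^f(\tilde{q}_0,\tilde{s})$ for some $\tilde{s}\in\tilde{E}^*$. $\mathcal{L}_{\tilde{G}}\in\mathcal{F}(\tilde{E}^*)$ is given by $\mathcal{L}_{\tilde{G}}(\epsilon)=1$ and, for $\tilde{s}\ne\epsilon$, $\mathcal{L}_{\tilde{G}}(\tilde{s})$ is the largest entry of $\tilde{q}_0\circ\tilde{s}$. A fuzzy language is an element $\mathcal{L}$ of $\mathcal{F}(\tilde{E}^*)$ that is either identically $0$ or satisfies $\mathcal{L}(\epsilon)=1$ and $\mathcal{L}(\tilde{s})\ge\mathcal{L}(\tilde{s}\tilde{a})$ for all $\tilde{s}\in\tilde{E}^*,\tilde{a}\in\tilde{E}$. Concatenation: $(\mathcal{L}_1\mathcal{L}_2)(\tilde{s})=\bigvee\{\mathcal{L}_1(\tilde{s}_1)\wedge\mathcal{L}_2(\tilde{s}_2):\tilde{s}_1\tilde{s}_2=\tilde{s}\}$.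 Let $\mathcal{E}_{uc}\in\mathcal{F}(\tilde{E}^*)$ equal $\tilde{E}_{uc}$ on $\tilde{E}$ and $0$ on $\tilde{E}^*\setminus\tilde{E}$. A fuzzy language $\mathcal{K}\subseteq\mathcal{L}_{\tilde{G}}$ is controllable (with respect to $\mathcal{L}_{\tilde{G}}$ and $\tilde{E}_{uc}$) if $\mathcal{K}\mathcal{E}_{uc}\cap\mathcal{L}_{\tilde{G}}\subseteq\mathcal{K}$. It is consistent if for any $\tilde{s}_1,\tilde{s}_2\in\tilde{E}^*$ and $\tilde{a}\in\tilde{E}$ with $\mathcal{K}(\tilde{s}_1\tilde{a})\ne0$ and $\mathcal{K}(\tilde{s}_2\tilde{a})\ne0$, the equality $\mathcal{K}(\tilde{s}_1)\cdot(\tilde{q}_0\circ\tilde{s}_1)=\mathcal{K}(\tilde{s}_2)\cdot(\tilde{q}_0\circ\tilde{s}_2)$ implies $\mathcal{K}(\tilde{s}_1\tilde{a})=\mathcal{K}(\tilde{s}_2\tilde{a})$. Controllability of a state set. Let $P\subseteq\tilde{Q}$. For $\tilde{q}\in P$ let $$\mathrm{Succ}(\tilde{q})=\{(\tilde{a},\tilde{p}):\tilde{a}\in\tilde{E},\ \tilde{p}\in P,\ \exists\,\alpha\in[0,1],\ \alpha\ge\tilde{E}_{uc}(\tilde{a}),\ \alpha\cdot(\tilde{q}\circ\tilde{a})=\tilde{p}\}.$$ A subset $C(\tilde{q})\subseteq\mathrm{Succ}(\tilde{q})$ is compatible if: (C1) for any $(\tilde{a}_1,\tilde{p}_1),(\tilde{a}_2,\tilde{p}_2)\in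 C(\tilde{q})$, $\tilde{a}_1=\tilde{a}_2$ implies $\tilde{p}_1=\tilde{p}_2$; (C2) if $\tilde{a}\in\tilde{E}$ with $\tilde{E}_{uc}(\tilde{a})>0$ and $\tilde{q}\circ\tilde{a}\ne0$, then $(\tilde{a},\tilde{p})\in C(\tilde{q})$ for some $\tilde{p}\in P$. The set $P$ is controllable if one can select for each $\tilde{q}\in P$ a compatible subset $C(\tilde{q})$ of $\mathrm{Succ}(\tilde{q})$ such that for each $\tilde{p}\in P$ there exist an integer $k\ge0$ and a sequence $(\tilde{q}_0,\tilde{a}_1,\tilde{q}_1,\ldots,\tilde{a}_k,\tilde{q}_k=\tilde{p})$, starting at the initial state $\tilde{q}_0$, with $\tilde{q}_{i-1}\in P$ and $(\tilde{a}_i,\tilde{q}_i)\in C(\tilde{q}_{i-1})$ for $i=1,\ldots,k$. -}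

module Defs where

open import Level using (0ℓ; suc)
open import Data.Nat.Base as ℕ using (ℕ)
open import Data.Fin.Base using (Fin)
open import Data.Rational.Base as ℚ using (ℚ; 0ℚ; 1ℚ)
import Data.Rational.Properties as ℚ
open import Data.List.Base using (List; []; _∷_; _++_; _∷ʳ_; foldl)
open import Data.Product.Base using (Σ; ∃; ∃-syntax; _×_; _,_; proj₁; proj₂)
open import Data.Sum.Base using (_⊎_; inj₁; inj₂)
open import Data.Vec.Functional using (Vector)
open import Data.Vec.Functional.Relation.Binary.Pointwise using (Pointwise)
open import Function.Definitions using (Injective)
open import Relation.Binary.Definitions using (tri<; tri≈; tri>)
open import Relation.Binary.PropositionalEquality using (_≡_; refl)
open import Relation.Nullary using (¬_)
open import Relation.Unary using (Pred; _∈_)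

------------------------------------------------------------------------
-- The real unit interval

-- A real number is a (left) Dedekind cut: a set of rationals that is closed
-- downwards and has no greatest element.  The cuts between 0 and 1 are those
-- containing every q < 0 and contained in {q | q < 1}.  Without excluded
-- middle these would only be the lower reals.

record 𝕀 : Set₁ where
  field
    cut     : Pred ℚ 0ℓ
    down    : ∀ {p q} → p ℚ.< q → cut q → cut p
    rounded : ∀ {p} → cut p → ∃[ q ] p ℚ.< q × cut q
    0≤cut   : ∀ {q} → q ℚ.< 0ℚ → cut q
    cut≤1   : ∀ {q} → cut q → q ℚ.< 1ℚ

open 𝕀 public

infix 4 _≤_ _≈_ _<_

-- A record rather than a bare function type, so that x and y can be inferred.
record _≤_ (x y : 𝕀) : Set where
  constructor ≤-intro
  field
    include : ∀ {q} → cut x q → cut y q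

open _≤_ public

-- Cuts are equal when they have the same elements.
_≈_ : 𝕀 → 𝕀 → Set
x ≈ y = x ≤ y × y ≤ x

_<_ : 𝕀 → 𝕀 → Set
x < y = x ≤ y × ¬ (x ≈ y)

0𝕀 : 𝕀
0𝕀 = record
  { cut     = ℚ._< 0ℚ
  ; down    = ℚ.<-trans
  ; rounded = λ p<0 → let q , p<q , q<0 = ℚ.<-dense p<0 in q , p<q , q<0
  ; 0≤cut   = λ q<0 → q<0
  ; cut≤1   = λ q<0 → ℚ.<-trans q<0 (ℚ.positive⁻¹ 1ℚ)
  }

1𝕀 : 𝕀
1𝕀 = record
  { cut     = ℚ._< 1ℚ
  ; down    = ℚ.<-trans
  ; rounded = λ p<1 → let q , p<q , q<1 = ℚ.<-dense p<1 in q , p<q , q<1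
  ; 0≤cut   = λ q<0 → ℚ.<-trans q<0 (ℚ.positive⁻¹ 1ℚ)
  ; cut≤1   = λ q<1 → q<1
  }

infixr 7 _∧_
infixr 6 _∨_

-- The order is inclusion of cuts, so minimum, maximum and supremum are
-- intersection, union and indexed union.

_∧_ : 𝕀 → 𝕀 → 𝕀
x ∧ y = record
  { cut     = λ q → cut x q × cut y q
  ; down    = λ p<q (qx , qy) → down x p<q qx , down y p<q qy
  ; rounded = λ (px , py) → common (rounded x px) (rounded y py)
  ; 0≤cut   = λ q<0 → 0≤cut x q<0 , 0≤cut y q<0
  ; cut≤1   = λ (qx , _) → cut≤1 x qx
  }
  where
  common : ∀ {p} → ∃[ q ] p ℚ.< q × cut x q → ∃[ q ] p ℚ.< q × cut y q →
           ∃[ q ] p ℚ.< q × cut x q × cut y q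
  common (q , p<q , qx) (r , p<r , ry) with ℚ.<-cmp q r
  ... | tri< q<r _ _    = q , p<q , qx , down y q<r ry
  ... | tri≈ _ refl _   = q , p<q , qx , ry
  ... | tri> _ _ r<q    = r , p<r , down x r<q qx , ry

_∨_ : 𝕀 → 𝕀 → 𝕀
x ∨ y = record
  { cut     = λ q → cut x q ⊎ cut y q
  ; down    = λ { p<q (inj₁ qx) → inj₁ (down x p<q qx)
                ; p<q (inj₂ qy) → inj₂ (down y p<q qy) }
  ; rounded = λ { (inj₁ px) → let q , p<q , qx = rounded x px in q , p<q , inj₁ qx
                ; (inj₂ py) → let q , p<q , qy = rounded y py in q , p<q , inj₂ qy }
  ; 0≤cut   = λ q<0 → inj₁ (0≤cut x q<0)
  ; cut≤1   = λ { (inj₁ qx) → cut≤1 x qx ; (inj₂ qy) → cut≤1 y qy }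
  }

-- Taking the union with the cut of 0 makes the supremum of the empty family 0.
⋁ : {I : Set} → (I → 𝕀) → 𝕀
⋁ {I} x = record
  { cut     = λ q → q ℚ.< 0ℚ ⊎ ∃[ i ] cut (x i) q
  ; down    = λ { p<q (inj₁ q<0)      → inj₁ (ℚ.<-trans p<q q<0)
                ; p<q (inj₂ (i , qx)) → inj₂ (i , down (x i) p<q qx) }
  ; rounded = λ { (inj₁ p<0)      → let q , p<q , q<0 = rounded 0𝕀 p<0 in q , p<q , inj₁ q<0
                ; (inj₂ (i , px)) → let q , p<q , qx = rounded (x i) px in q , p<q , inj₂ (i , qx) }
  ; 0≤cut   = inj₁
  ; cut≤1   = λ { (inj₁ q<0) → cut≤1 0𝕀 q<0 ; (inj₂ (i , qx)) → cut≤1 (x i) qx }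
  }

------------------------------------------------------------------------
-- Fuzzy subsets

𝓕 : Set → Set₁
𝓕 X = X → 𝕀

infix  4 _⊆_
infixr 7 _∩_

_⊆_ : {X : Set} → 𝓕 X → 𝓕 X → Set
A ⊆ B = ∀ x → A x ≤ B x

_∩_ : {X : Set} → 𝓕 X → 𝓕 X → 𝓕 X
(A ∩ B) x = A x ∧ B x

------------------------------------------------------------------------
-- Row vectors and matrices over the unit interval

Row : ℕ → Set₁
Row n = Vector 𝕀 n

Matrix : ℕ → Set₁
Matrix n = Vector (Row n) n

infix  4 _≋_ _≋ₘ_
infixl 8 _∘_
infixr 7 _·_

_≋_ : ∀ {n} → Row n → Row n → Set
_≋_ = Pointwise _≈_

_≋ₘ_ : ∀ {n} → Matrix n → Matrix n → Set
_≋ₘ_ = Pointwise _≋_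

0ᵣ : ∀ {n} → Row n
0ᵣ _ = 0𝕀

-- Max-min composition of a 1 × n matrix with an n × n matrix.
_∘_ : ∀ {n} → Row n → Matrix n → Row n
(x ∘ A) j = ⋁ λ l → x l ∧ A l j

_·_ : ∀ {n} → 𝕀 → Row n → Row n
(α · x) i = α ∧ x i

record FuzzyState (n : ℕ) : Set₁ where
  field
    row     : Row n
    nonzero : ¬ (row ≋ 0ᵣ)

open FuzzyState public

infix 4 _≈ₛ_

_≈ₛ_ : ∀ {n} → FuzzyState n → FuzzyState n → Set
q ≈ₛ p = row q ≋ row p

------------------------------------------------------------------------
-- Fuzzy discrete event systems

-- The finite set of fuzzy events is given by an enumeration without
-- repetitions, and an event is referred to by its position.
record FuzzyDES : Set₁ where
  field
    dim             : ℕ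
    1≤dim           : 1 ℕ.≤ dim
    #events         : ℕ
    matrix          : Fin #events → Matrix dim
    matrix-distinct : Injective _≡_ _≋ₘ_ matrix
    q₀              : FuzzyState dim

  State : Set₁
  State = FuzzyState dim

  Event : Set
  Event = Fin #events

  Event* : Set
  Event* = List Event

  infixl 8 _∘*_

  -- The result is a row vector, which may be zero.
  _∘*_ : Row dim → Event* → Row dim
  x ∘* s = foldl (λ y a → y ∘ matrix a) x s

  𝓛 : 𝓕 Event*
  𝓛 []        = 1𝕀
  𝓛 s@(_ ∷ _) = ⋁ (row q₀ ∘* s)

module _ (G : FuzzyDES) where

  open FuzzyDES G

  ----------------------------------------------------------------------
  -- Fuzzy languages

  IsFuzzyLanguage : 𝓕 Event* → Set
  IsFuzzyLanguage L =
    (∀ s → L s ≈ 0𝕀) ⊎ (L [] ≈ 1𝕀 × (∀ s a → L (s ∷ʳ a) ≤ L s))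

  concat : 𝓕 Event* → 𝓕 Event* → 𝓕 Event*
  concat L₁ L₂ s =
    ⋁ {Σ (Event* × Event*) λ (s₁ , s₂) → s₁ ++ s₂ ≡ s} λ ((s₁ , s₂) , _) → L₁ s₁ ∧ L₂ s₂

  module _ (Euc : 𝓕 Event) where

    𝓔uc : 𝓕 Event*
    𝓔uc []          = 0𝕀
    𝓔uc (a ∷ [])    = Euc a
    𝓔uc (_ ∷ _ ∷ _) = 0𝕀

    ControllableLanguage : 𝓕 Event* → Set
    ControllableLanguage K = concat K 𝓔uc ∩ 𝓛 ⊆ K

  Consistent : 𝓕 Event* → Set
  Consistent K = ∀ s₁ s₂ a →
    ¬ (K (s₁ ∷ʳ a) ≈ 0𝕀) → ¬ (K (s₂ ∷ʳ a) ≈ 0𝕀) →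
    K s₁ · (row q₀ ∘* s₁) ≋ K s₂ · (row q₀ ∘* s₂) →
    K (s₁ ∷ʳ a) ≈ K (s₂ ∷ʳ a)

  ----------------------------------------------------------------------
  -- Fuzzy state feedback control

  module _ (Euc : 𝓕 Event) where

    -- Since equality of states is _≈ₛ_, being a function on states means
    -- preserving it.
    record IsFSFC (f : State → 𝓕 Event) : Set₁ where
      field
        cong     : ∀ {q p} → q ≈ₛ p → ∀ a → f q a ≈ f p a
        uc-bound : ∀ q a → Euc a ≤ f q a

  -- The partial map δᶠ is represented by its graph; as a fuzzy state is
  -- nonzero, nothing is related to (q , a) when the vector on the right is zero.
  δᶠ : (State → 𝓕 Event) → State → Event → State → Set
  δᶠ f q a p = row p ≋ f q a · (row q ∘ matrix a)

  -- The graph of the extension of δᶠ to strings.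
  data δᶠ* (f : State → 𝓕 Event) (q : State) : Event* → State → Set₁ where
    empty : ∀ {p} → p ≈ₛ q → δᶠ* f q [] p
    snoc  : ∀ {s a r p} → δᶠ* f q s r → δᶠ f r a p → δᶠ* f q (s ∷ʳ a) p

  ReachableStates : (State → 𝓕 Event) → Pred State (suc 0ℓ)
  ReachableStates f q = ∃[ s ] δᶠ* f q₀ s q

  ----------------------------------------------------------------------
  -- Controllable sets of fuzzy states

  module _ (Euc : 𝓕 Event) (P : Pred State 0ℓ) where

    Succ : State → Pred (Event × State) (suc 0ℓ)
    Succ q (a , p) = p ∈ P × (∃[ α ] Euc a ≤ α × α · (row q ∘ matrix a) ≋ row p)

    record Compatible (q : State) (Cq : Pred (Event × State) 0ℓ) : Set₁ where
      field
        ⊆Succ : ∀ {a p} → (a , p) ∈ Cq → (a , p) ∈ Succ q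
        C1    : ∀ {a₁ p₁ a₂ p₂} → (a₁ , p₁) ∈ Cq → (a₂ , p₂) ∈ Cq → a₁ ≡ a₂ → p₁ ≈ₛ p₂
        C2    : ∀ a → 0𝕀 < Euc a → ¬ (row q ∘ matrix a ≋ 0ᵣ) →
                ∃[ p ] p ∈ P × (a , p) ∈ Cq

    -- Chain C p: there is a sequence (q₀, a₁, q₁, …, aₖ, qₖ = p) as required.
    data Chain (C : State → Pred (Event × State) 0ℓ) : State → Set₁ where
      start : ∀ {p} → p ≈ₛ q₀ → Chain C p
      step  : ∀ {q a p} → Chain C q → q ∈ P → (a , p) ∈ C q → Chain C p

    -- The values of C at states outside P are irrelevant.  The two _-resp
    -- fields say that P is a set of states and that C assigns to each state a
    -- set of pairs, with respect to _≈ₛ_.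
    record ControllableStateSet : Set₂ where
      field
        P-resp     : ∀ {q q′} → q ≈ₛ q′ → q ∈ P → q′ ∈ P
        C          : State → Pred (Event × State) 0ℓ
        C-resp     : ∀ {q q′ a p p′} → q ∈ P → q ≈ₛ q′ → p ≈ₛ p′ → (a , p) ∈ C q → (a , p′) ∈ C q′
        compatible : ∀ {q} → q ∈ P → Compatible q (C q)
        reachable  : ∀ {p} → p ∈ P → Chain C p

  ----------------------------------------------------------------------
  -- The states and the controller determined by a fuzzy language

  module _ (K : 𝓕 Event*) where

    S : State → Pred Event* 0ℓ
    S q s = K s · (row q₀ ∘* s) ≋ row q

    R : Pred State 0ℓ
    R q = ∃[ s ] s ∈ S q

    controller : 𝓕 Event → State → 𝓕 Event
    controller Euc q a = (⋁ {∃[ s ] s ∈ S q} λ (s , _) → K (s ∷ʳ a)) ∨ Euc a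

{-# OPTIONS --safe #-}

-- For s in S_K(q), the vectors f(q)(a) · (q ∘ a) and K(sa) · (q₀ ∘ sa) agree as
-- soon as K(s'a) ≤ K(sa) for all s' in S_K(q): then the supremum in f(q)(a)
-- contributes exactly K(sa), and controllability absorbs the uncontrollable part.
-- By consistency K(s'a) takes at most one nonzero value for s' in S_K(q), so every
-- s with K(sa) ≠ 0 is maximal in this sense, and a maximal s always exists.  Hence
-- the transitions of the closed loop stay inside R(K) and realise every string s
-- with K(s) · (q₀ ∘ s) ≠ 0.  The same transitions are the compatible selection.

module Submission where

open import Defs
open import Level using (0ℓ)
open import Axiom.ExcludedMiddle using (ExcludedMiddle)
open import Data.Empty using (⊥-elim)
open import Data.List.Base using ([]; _∷_; _∷ʳ_)
open import Data.List.Properties using (foldl-∷ʳ)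
open import Data.List.Reverse using (Reverse; []; _∶_∶ʳ_; reverseView)
open import Data.Product.Base using (∃-syntax; _×_; _,_; proj₁; proj₂)
open import Data.Rational.Base using (0ℚ)
import Data.Rational.Properties as ℚ
open import Data.Sum.Base using (inj₁; inj₂)
import Data.Vec.Functional.Relation.Binary.Pointwise.Properties as Pointwise
open import Function.Base using (id)
open import Relation.Binary.Bundles using (Poset; Setoid)
open import Relation.Binary.Definitions using (tri<; tri≈; tri>)
open import Relation.Binary.PropositionalEquality using (_≡_; refl; cong)
import Relation.Binary.Reasoning.Setoid as SetoidReasoning
open import Relation.Nullary using (¬_; yes; no)
open import Relation.Nullary.Decidable using (decidable-stable)
open import Relation.Unary using (_≐_; _∈_)

-- Order and zero in the unit interval.

≤-poset : Poset _ _ _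
≤-poset = record
  { Carrier        = 𝕀
  ; _≈_            = _≈_
  ; _≤_            = _≤_
  ; isPartialOrder = record
    { isPreorder = record
      { isEquivalence = record
        { refl  = ≤-intro id , ≤-intro id
        ; sym   = λ (x≤y , y≤x) → y≤x , x≤y
        ; trans = λ (x≤y , y≤x) (y≤z , z≤y) → ≤-trans x≤y y≤z , ≤-trans z≤y y≤x
        }
      ; reflexive     = proj₁
      ; trans         = ≤-trans
      }
    ; antisym    = _,_
    }
  }
  where
  ≤-trans : ∀ {x y z} → x ≤ y → y ≤ z → x ≤ z
  ≤-trans x≤y y≤z = ≤-intro λ q∈x → include y≤z (include x≤y q∈x)

module ≤ = Poset ≤-poset

module ≋ {n} = Setoid (Pointwise.setoid ≤.Eq.setoid n)

module ≋-Reasoning {n} = SetoidReasoning (Pointwise.setoid ≤.Eq.setoid n)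

0≤ : ∀ x → 0𝕀 ≤ x
0≤ x = ≤-intro (0≤cut x)

≤0⇒≈0 : ∀ {x} → x ≤ 0𝕀 → x ≈ 0𝕀
≤0⇒≈0 x≤0 = x≤0 , 0≤ _

-- Any nonnegative element of a cut pulls the rational 0 into it by `down`, so vanishing is tested
-- on a single rational.
0∉cut⇒≈0 : ∀ {x} → ¬ cut x 0ℚ → x ≈ 0𝕀
0∉cut⇒≈0 {x} 0∉x = ≤0⇒≈0 (≤-intro negative)
  where
  negative : ∀ {q} → cut x q → cut 0𝕀 q
  negative {q} q∈x with ℚ.<-cmp q 0ℚ
  ... | tri< q<0 _ _  = q<0
  ... | tri≈ _ refl _ = ⊥-elim (0∉x q∈x)
  ... | tri> _ _ 0<q  = ⊥-elim (0∉x (down x 0<q q∈x))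

-- Max-min algebra of rows.

·-cong : ∀ {n α β} {x y : Row n} → α ≈ β → x ≋ y → α · x ≋ β · y
·-cong (α≤β , β≤α) x≋y j =
  ≤-intro (λ (q∈α , q∈x) → include α≤β q∈α , include (proj₁ (x≋y j)) q∈x) ,
  ≤-intro (λ (q∈β , q∈y) → include β≤α q∈β , include (proj₂ (x≋y j)) q∈y)

∘-mono : ∀ {n} {x y : Row n} (A : Matrix n) → (∀ l → x l ≤ y l) → ∀ j → (x ∘ A) j ≤ (y ∘ A) j
∘-mono A x≤y j = ≤-intro λ
  { (inj₁ q<0)             → inj₁ q<0
  ; (inj₂ (l , q∈x , q∈A)) → inj₂ (l , include (x≤y l) q∈x , q∈A)
  }

∘-congˡ : ∀ {n} {x y : Row n} (A : Matrix n) → x ≋ y → x ∘ A ≋ y ∘ A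
∘-congˡ A x≋y j = ∘-mono A (λ l → proj₁ (x≋y l)) j , ∘-mono A (λ l → proj₂ (x≋y l)) j

-- Minimum distributes over supremum; the default disjunct `q < 0` of `⋁` is harmless because every
-- cut contains the negative rationals.
·-∘-assoc : ∀ {n} α (x : Row n) A → (α · x) ∘ A ≋ α · (x ∘ A)
·-∘-assoc α x A j =
  ≤-intro (λ { (inj₁ q<0)                     → 0≤cut α q<0 , inj₁ q<0
             ; (inj₂ (l , (q∈α , q∈x) , q∈A)) → q∈α , inj₂ (l , q∈x , q∈A) }) ,
  ≤-intro (λ { (q∈α , inj₁ q<0)             → inj₁ q<0
             ; (q∈α , inj₂ (l , q∈x , q∈A)) → inj₂ (l , (q∈α , q∈x) , q∈A) })

·-absorb : ∀ {n α β} → α ≤ β → (x : Row n) → α · (β · x) ≋ α · x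
·-absorb α≤β x j =
  ≤-intro (λ (q∈α , _ , q∈x) → q∈α , q∈x) ,
  ≤-intro (λ (q∈α , q∈x) → q∈α , include α≤β q∈α , q∈x)

·-identity : ∀ {n α} → α ≈ 1𝕀 → (x : Row n) → α · x ≋ x
·-identity α≈1 x j =
  ≤-intro proj₂ ,
  ≤-intro (λ q∈x → include (proj₂ α≈1) (cut≤1 (x j) q∈x) , q∈x)

·-zeroˡ : ∀ {n α} → α ≈ 0𝕀 → (x : Row n) → α · x ≋ 0ᵣ
·-zeroˡ α≈0 x j = ≤0⇒≈0 (≤-intro λ (q∈α , _) → include (proj₁ α≈0) q∈α)

·-zeroʳ : ∀ {n} α → α · 0ᵣ {n} ≋ 0ᵣ
·-zeroʳ α j = ≤0⇒≈0 (≤-intro proj₂)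

∘-zeroˡ : ∀ {n} (A : Matrix n) → 0ᵣ ∘ A ≋ 0ᵣ
∘-zeroˡ A j = ≤0⇒≈0 (≤-intro λ { (inj₁ q<0) → q<0 ; (inj₂ (_ , q<0 , _)) → q<0 })

-- If the rational 0 lay in both cuts, it would lie in their minimum, which is 0. Nesting the
-- negations avoids deciding which entry is nonzero.
·-nonzero : ∀ {n α} {x : Row n} → ¬ (α ≈ 0𝕀) → ¬ (x ≋ 0ᵣ) → ¬ (α · x ≋ 0ᵣ)
·-nonzero α≉0 x≉0 αx≋0 = x≉0 λ j → 0∉cut⇒≈0 λ 0∈x → α≉0 (0∉cut⇒≈0 λ 0∈α →
  ℚ.<-irrefl refl (include (proj₁ (αx≋0 j)) (0∈α , 0∈x)))

-- Rows attached to strings.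

module _ (G : FuzzyDES) where

  open FuzzyDES G

  ∘*-∷ʳ : ∀ x s a → x ∘* (s ∷ʳ a) ≡ (x ∘* s) ∘ matrix a
  ∘*-∷ʳ x s a = foldl-∷ʳ (λ y b → y ∘ matrix b) x a s

  row≤𝓛 : ∀ s j → (row q₀ ∘* s) j ≤ 𝓛 s
  -- `𝓛 []` is 1 by convention, not the largest entry of `q₀`.
  row≤𝓛 []      j = ≤-intro (cut≤1 (row q₀ j))
  row≤𝓛 (_ ∷ _) j = ≤-intro λ q∈ → inj₂ (j , q∈)

  module _
    (em : ExcludedMiddle 0ℓ) (Euc : 𝓕 Event) (K : 𝓕 Event*)
    (K-ε : K [] ≈ 1𝕀) (K-prefix : ∀ s a → K (s ∷ʳ a) ≤ K s)
    (controllable : ControllableLanguage G Euc K)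
    (consistent : Consistent G K)
    where

    private

      f : State → 𝓕 Event
      f = controller G K Euc

      V : Event* → Row dim
      V s = K s · (row q₀ ∘* s)

    V-ε : V [] ≋ row q₀
    V-ε = ·-identity K-ε (row q₀)

    S-resp : ∀ {q p s} → q ≈ₛ p → s ∈ S G K q → s ∈ S G K p
    S-resp q≈p s∈Sq = ≋.trans s∈Sq q≈p

    S-∘ : ∀ {q s} a → s ∈ S G K q → row q ∘ matrix a ≋ K s · (row q₀ ∘* (s ∷ʳ a))
    S-∘ {q} {s} a s∈Sq = begin
      row q ∘ matrix a                   ≈⟨ ∘-congˡ (matrix a) s∈Sq ⟨
      V s ∘ matrix a                     ≈⟨ ·-∘-assoc (K s) (row q₀ ∘* s) (matrix a) ⟩
      K s · ((row q₀ ∘* s) ∘ matrix a)   ≡⟨ cong (K s ·_) (∘*-∷ʳ (row q₀) s a) ⟨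
      K s · (row q₀ ∘* (s ∷ʳ a))         ∎
      where open ≋-Reasoning

    -- As `K (s ∷ʳ a) ≤ K s`, the factor `K s` can be inserted, giving
    -- `K (s ∷ʳ a) · (V s ∘ matrix a)`, which vanishes with `V s`. This makes `V s` a fuzzy state.
    V-prefix-nonzero : ∀ s a → ¬ (V (s ∷ʳ a) ≋ 0ᵣ) → ¬ (V s ≋ 0ᵣ)
    V-prefix-nonzero s a Vsa≉0 Vs≋0 = Vsa≉0 (begin
      V (s ∷ʳ a)                                        ≈⟨ ·-absorb (K-prefix s a) _ ⟨
      K (s ∷ʳ a) · (K s · (row q₀ ∘* (s ∷ʳ a)))         ≡⟨ cong (λ x → K (s ∷ʳ a) · (K s · x)) (∘*-∷ʳ (row q₀) s a) ⟩
      K (s ∷ʳ a) · (K s · ((row q₀ ∘* s) ∘ matrix a))   ≈⟨ ·-cong ≤.Eq.refl (·-∘-assoc (K s) (row q₀ ∘* s) (matrix a)) ⟨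
      K (s ∷ʳ a) · (V s ∘ matrix a)                     ≈⟨ ·-cong ≤.Eq.refl (∘-congˡ (matrix a) Vs≋0) ⟩
      K (s ∷ʳ a) · (0ᵣ ∘ matrix a)                      ≈⟨ ·-cong ≤.Eq.refl (∘-zeroˡ (matrix a)) ⟩
      K (s ∷ʳ a) · 0ᵣ                                   ≈⟨ ·-zeroʳ (K (s ∷ʳ a)) ⟩
      0ᵣ                                                ∎)
      where open ≋-Reasoning

    controllable-∷ʳ : ∀ s a {q} → cut (K s) q → cut (Euc a) q → cut (𝓛 (s ∷ʳ a)) q → cut (K (s ∷ʳ a)) q
    controllable-∷ʳ s a q∈K q∈E q∈L =
      -- The split before the last letter is the only one on which `𝓔uc` can be nonzero.
      include (controllable (s ∷ʳ a)) (inj₂ (((s , a ∷ []) , refl) , q∈K , q∈E) , q∈L)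

    -- The controller and its transitions.

    Maximal : State → Event → Event* → Set
    Maximal q a s = ∀ {s′} → s′ ∈ S G K q → K (s′ ∷ʳ a) ≤ K (s ∷ʳ a)

    controller-∘ : ∀ {q s} a → s ∈ S G K q → Maximal q a s →
                   f q a · (row q ∘ matrix a) ≋ V (s ∷ʳ a)
    controller-∘ {q} {s} a s∈Sq max = begin
      f q a · (row q ∘ matrix a)             ≈⟨ ·-cong ≤.Eq.refl (S-∘ {q} a s∈Sq) ⟩
      f q a · (K s · (row q₀ ∘* (s ∷ʳ a)))   ≈⟨ (λ j → ≤-intro (to j) , ≤-intro from) ⟩
      V (s ∷ʳ a)                             ∎
      where
      open ≋-Reasoning

      to : ∀ j {r} → cut ((f q a · (K s · (row q₀ ∘* (s ∷ʳ a)))) j) r → cut (V (s ∷ʳ a) j) r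
      -- A rational below `f q a` comes from the default value of the supremum, from a rival string,
      -- or from `Euc a`.
      to j (inj₁ (inj₁ r<0) , _ , r∈v)                 = 0≤cut (K (s ∷ʳ a)) r<0 , r∈v
      to j (inj₁ (inj₂ ((_ , s′∈Sq) , r∈K)) , _ , r∈v) = include (max s′∈Sq) r∈K , r∈v
      to j (inj₂ r∈E , r∈K , r∈v)                      =
        controllable-∷ʳ s a r∈K r∈E (include (row≤𝓛 (s ∷ʳ a) j) r∈v) , r∈v

      from : ∀ {j r} → cut (V (s ∷ʳ a) j) r → cut ((f q a · (K s · (row q₀ ∘* (s ∷ʳ a)))) j) r
      from (r∈K , r∈v) = inj₁ (inj₂ ((s , s∈Sq) , r∈K)) , include (K-prefix s a) r∈K , r∈v

    nonzero⇒maximal : ∀ {q s a} → s ∈ S G K q → ¬ (K (s ∷ʳ a) ≈ 0𝕀) → Maximal q a s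
    -- Consistency compares nonzero values only, so vanishing of the rival is decided first.
    nonzero⇒maximal {q} {s} {a} s∈Sq Ksa≉0 {s′} s′∈Sq with em {K (s′ ∷ʳ a) ≈ 0𝕀}
    ... | yes Ks′a≈0 = ≤.trans (proj₁ Ks′a≈0) (0≤ _)
    ... | no  Ks′a≉0 = proj₁ (consistent s′ s a Ks′a≉0 Ksa≉0 (≋.trans s′∈Sq (≋.sym s∈Sq)))

    maximal-exists : ∀ {q} a → q ∈ R G K → ∃[ s ] s ∈ S G K q × Maximal q a s
    -- If no string over `q` has a nonzero value at `a`, all values are 0 and any string will do,
    -- such as `s₀`.
    maximal-exists {q} a (s₀ , s₀∈Sq)
      with em {∃[ s ] s ∈ S G K q × ¬ (K (s ∷ʳ a) ≈ 0𝕀)}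
    ... | yes (s , s∈Sq , Ksa≉0) = s , s∈Sq , nonzero⇒maximal {q} s∈Sq Ksa≉0
    ... | no  all-zero           = s₀ , s₀∈Sq , λ {s} s∈Sq →
      -- `all-zero` yields only a double negation, which excluded middle removes.
      ≤.trans (proj₁ (decidable-stable em λ Ksa≉0 → all-zero (s , s∈Sq , Ksa≉0))) (0≤ _)

    controller-cong : ∀ {q p} → q ≈ₛ p → ∀ a → f q a ≈ f p a
    controller-cong {q} {p} q≈p a = mono q p q≈p , mono p q (≋.sym q≈p)
      where
      mono : ∀ q p → q ≈ₛ p → f q a ≤ f p a
      mono q p q≈p = ≤-intro λ
        { (inj₁ (inj₁ r<0))                → inj₁ (inj₁ r<0)
        ; (inj₁ (inj₂ ((s , s∈Sq) , r∈K))) → inj₁ (inj₂ ((s , S-resp {q} {p} {s} q≈p s∈Sq) , r∈K))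
        ; (inj₂ r∈E)                       → inj₂ r∈E
        }

    Euc≤controller : ∀ q a → Euc a ≤ f q a
    Euc≤controller q a = ≤-intro inj₂

    -- Reachable states of the closed loop.

    δᶠ-R : ∀ {q a p} → q ∈ R G K → δᶠ G f q a p → p ∈ R G K
    δᶠ-R {q} {a} q∈R p≋ =
      -- The string witnessing `q ∈ R G K` need not be maximal for `a`, so it is exchanged for one
      -- that is.
      let s , s∈Sq , max = maximal-exists {q} a q∈R
      in s ∷ʳ a , ≋.sym (≋.trans p≋ (controller-∘ {q} a s∈Sq max))

    reachable⇒R : ∀ {s p} → δᶠ* G f q₀ s p → p ∈ R G K
    reachable⇒R (empty p≈q₀) = [] , ≋.trans V-ε (≋.sym p≈q₀)
    reachable⇒R (snoc {r = r} {p} q₀→r r→p) = δᶠ-R {r} {p = p} (reachable⇒R q₀→r) r→p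

    -- Induction removes the last letter, whence the reverse view. As `p` is nonzero, so is
    -- `K (s ∷ʳ a)`; thus `s` itself is maximal for `a`, and the closed loop follows the given
    -- string.
    R⇒reachable : ∀ {s p} → Reverse s → s ∈ S G K p → δᶠ* G f q₀ s p
    R⇒reachable [] ε∈Sp = empty (≋.trans (≋.sym ε∈Sp) V-ε)
    R⇒reachable {p = p} (s ∶ rs ∶ʳ a) sa∈Sp =
      snoc (R⇒reachable {p = r} rs ≋.refl)
           (≋.trans (≋.sym sa∈Sp) (≋.sym (controller-∘ {r} a ≋.refl (nonzero⇒maximal {r} ≋.refl Ksa≉0))))
      where
      Vsa≉0 : ¬ (V (s ∷ʳ a) ≋ 0ᵣ)
      Vsa≉0 Vsa≋0 = nonzero p (≋.trans (≋.sym sa∈Sp) Vsa≋0)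

      r : State
      r = record { row = V s ; nonzero = V-prefix-nonzero s a Vsa≉0 }

      Ksa≉0 : ¬ (K (s ∷ʳ a) ≈ 0𝕀)
      Ksa≉0 Ksa≈0 = Vsa≉0 (·-zeroˡ Ksa≈0 _)

    reachable≐R : ReachableStates G f ≐ R G K
    reachable≐R =
      (λ (_ , q₀→p) → reachable⇒R q₀→p) ,
      (λ {p} (s , s∈Sp) → s , R⇒reachable {p = p} (reverseView s) s∈Sp)

    controller-isFSFC : IsFSFC G Euc f
    controller-isFSFC = record
      { cong     = λ {q} {p} → controller-cong {q} {p}
      ; uc-bound = Euc≤controller
      }

    -- The compatible selection.

    reachable⇒chain : ∀ {s p} → δᶠ* G f q₀ s p → Chain G Euc (R G K) (λ q (a , p) → δᶠ G f q a p) p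
    reachable⇒chain (empty p≈q₀)    = start p≈q₀
    reachable⇒chain (snoc q₀→r r→p) = step (reachable⇒chain q₀→r) (reachable⇒R q₀→r) r→p

    R-controllable : ControllableStateSet G Euc (R G K)
    R-controllable = record
      { P-resp     = λ {q} {q′} q≈q′ (s , s∈Sq) → s , S-resp {q} {q′} {s} q≈q′ s∈Sq
      ; C          = λ q (a , p) → δᶠ G f q a p
      ; C-resp     = λ {q} {q′} {a} _ q≈q′ p≈p′ p≋ →
          ≋.trans (≋.sym p≈p′) (≋.trans p≋
            (·-cong (controller-cong {q} {q′} q≈q′ a) (∘-congˡ (matrix a) q≈q′)))
      ; compatible = λ {q} q∈R → record
        { ⊆Succ = λ {a} {p} p≋ → δᶠ-R {q} {a} {p} q∈R p≋ , f q a , Euc≤controller q a , ≋.sym p≋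
        ; C1    = λ { p₁≋ p₂≋ refl → ≋.trans p₁≋ (≋.sym p₂≋) }
        ; C2    = λ a 0<Euc qa≉0 →
            let
              -- A positive `Euc a` forces `f q a` to be nonzero, so the transition along `a` is
              -- defined.
              fqa≉0 : ¬ (f q a ≈ 0𝕀)
              fqa≉0 fqa≈0 = proj₂ 0<Euc (0≤ _ , ≤.trans (Euc≤controller q a) (proj₁ fqa≈0))

              p : State
              p = record { row = f q a · (row q ∘ matrix a) ; nonzero = ·-nonzero fqa≉0 qa≉0 }
            in p , δᶠ-R {q} {a} {p} q∈R ≋.refl , ≋.refl
        }
      ; reachable  = λ {p} (s , s∈Sp) → reachable⇒chain (R⇒reachable {p = p} (reverseView s) s∈Sp)
      }

theorem4 : ExcludedMiddle 0ℓ →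
    (G : FuzzyDES) (Euc : 𝓕 (FuzzyDES.Event G)) (K : 𝓕 (FuzzyDES.Event* G)) →
    IsFuzzyLanguage G K →
    K ⊆ FuzzyDES.𝓛 G →
    ¬ (∀ s → K s ≈ 0𝕀) →
    ControllableLanguage G Euc K →
    Consistent G K →
    ControllableStateSet G Euc (R G K)
    × (IsFSFC G Euc (controller G K Euc)
    × ReachableStates G (controller G K Euc) ≐ R G K)
theorem4 _ _ _ _ (inj₁ K≈0) _ K≉0 _ _ = ⊥-elim (K≉0 K≈0)
theorem4 em G Euc K (inj₂ (K-ε , K-prefix)) _ _ controllable consistent =
  R-controllable G em Euc K K-ε K-prefix controllable consistent ,
  controller-isFSFC G em Euc K K-ε K-prefix controllable consistent ,
  reachable≐R G em Euc K K-ε K-prefix controllable consistent
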